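{- The following are equivalent: (1) the decidable bar induction ${\rm BI_D}$; (2) every $K_0$-realisable function $F\colon\mathbb{N}^{\mathbb{N}}\to\mathbb{N}$ is $K$-realisable; (3) every function $F\colon\mathbb{N}^{\mathbb{N}}\to\mathbb{N}$ that has a pointwise continuous modulus is $K$-realisable.
   Context: Work in Bishop-style constructive mathematics (no excluded middle), with countable choice for sequences and unique choice for functions $\mathbb{N}^{\mathbb{N}}\to\mathbb{N}$ (for decidable relations); "equivalent" means mutually derivable over this base. Notation: $\mathbb{N}^*$ finite sequences, $a*b$ concatenation, $\langle\rangle$, $\langle n\rangle$ empty and one-element sequences, $\overline{\alpha}n$ initial segment of length $n$, $\beta\in a$ means $\overline{\beta}|a|=a$. A bar is $P\subseteq\mathbb{N}^*$ with $(\forall\alpha\in\mathbb{N}^{\mathbb{N}})(\exists n)P(\overline{\alpha}n)$; detachable means $(\forall a)(P(a)\vee\neg P(a))$. $Q$ is inductive if $(\forall a)[(\forall n)Q(a*\langle n\rangle)\to Q(a)]$. ${\rm BI_D}$: for every detachable bar $P$ and every $Q\subseteq\mathbb{N}^*$, if $P\subseteq Q$ and $Q$ is inductive then $Q(\langle\rangle)$. $K$ (Brouwer-operations) is the predicate on $\mathbb{N}^{\mathbb{N}^*}$ inductively defined (least class, with induction principle) by: $\lambda a.\,n+1\in K$ for each $n$; if $\gamma(\langle\rangle)=0$ and $\lambda a.\,\gamma(\langle n\rangle*a)\in K$ for all $n$, then $\gamma\in K$. $K_0$ (neighbourhood functions) is the set of $\gamma\colon\mathbb{N}^*\to\mathbb{N}$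 with $(\forall\alpha)(\exists n)\gamma(\overline{\alpha}n)>0$ and $(\forall a,b)[\gamma(a)>0\to\gamma(a)=\gamma(a*b)]$. For $\gamma\in K_0$ (in particular $\gamma\in K$), $F_\gamma(\alpha)=\gamma(\overline{\alpha}m)-1$ with $m$ least such that $\gamma(\overline{\alpha}m)>0$. $F$ is $K$-realisable (resp. $K_0$-realisable) if $F=F_\gamma$ for some $\gamma\in K$ (resp. $\gamma\in K_0$). $g\colon\mathbb{N}^{\mathbb{N}}\to\mathbb{N}$ is a modulus of $F$ if $(\forall\alpha)(\forall\beta\in\overline{\alpha}g(\alpha))F(\beta)=F(\alpha)$. $g$ is pointwise continuous if $(\forall\alpha)(\exists n)(\forall\beta)[\overline{\beta}n=\overline{\alpha}n\to g(\beta)=g(\alpha)]$. -}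

module Defs where

open import Data.Nat using (ℕ; zero; suc; _<_; pred)
open import Data.List using (List; []; _∷_; _++_; length)
open import Data.Product using (Σ; ∃; _×_)
open import Data.Sum using (_⊎_)
open import Relation.Nullary using (¬_)
open import Relation.Binary.PropositionalEquality using (_≡_)
open import Function.Bundles using (_⇔_)

Seq : Set
Seq = List ℕ

Baire : Set
Baire = ℕ → ℕ

init : Baire → ℕ → Seq
init α zero    = []
init α (suc n) = α 0 ∷ init (λ k → α (suc k)) n

_∈ₛ_ : Baire → Seq → Set
β ∈ₛ a = init β (length a) ≡ a

Bar : (Seq → Set) → Set
Bar P = (α : Baire) → ∃ λ n → P (init α n)

Detachable : (Seq → Set) → Set
Detachable P = (a : Seq) → P a ⊎ ¬ P a

Inductive : (Seq → Set) → Set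
Inductive Q = (a : Seq) → ((n : ℕ) → Q (a ++ (n ∷ []))) → Q a

BI-D : Set₁
BI-D = (P Q : Seq → Set) → Detachable P → Bar P →
       ((a : Seq) → P a → Q a) → Inductive Q → Q []

-- Functions are taken
-- extensionally (Bishop): membership of "λ a. n+1" is stated up to
-- pointwise equality.
data K : (Seq → ℕ) → Set where
  kconst : (γ : Seq → ℕ) (n : ℕ) → ((a : Seq) → γ a ≡ suc n) → K γ
  ksup   : (γ : Seq → ℕ) → γ [] ≡ 0 →
           ((n : ℕ) → K (λ a → γ (n ∷ a))) → K γ

K₀ : (Seq → ℕ) → Set
K₀ γ = ((α : Baire) → ∃ λ n → 0 < γ (init α n))
     × ((a b : Seq) → 0 < γ a → γ a ≡ γ (a ++ b))

LeastPos : (Seq → ℕ) → Baire → ℕ → Set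
LeastPos γ α m = (0 < γ (init α m)) × ((k : ℕ) → k < m → γ (init α k) ≡ 0)

Realises : (Seq → ℕ) → (Baire → ℕ) → Set
Realises γ F = (α : Baire) (m : ℕ) → LeastPos γ α m → F α ≡ pred (γ (init α m))

K-realisable : (Baire → ℕ) → Set
K-realisable F = Σ (Seq → ℕ) λ γ → K γ × Realises γ F

K₀-realisable : (Baire → ℕ) → Set
K₀-realisable F = Σ (Seq → ℕ) λ γ → K₀ γ × Realises γ F

Modulus : (Baire → ℕ) → (Baire → ℕ) → Set
Modulus F g = (α β : Baire) → β ∈ₛ init α (g α) → F β ≡ F α

PointwiseContinuous : (Baire → ℕ) → Set
PointwiseContinuous g =
  (α : Baire) → ∃ λ n → (β : Baire) → init β n ≡ init α n → g β ≡ g α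

AllK₀RealisableAreK : Set
AllK₀RealisableAreK = (F : Baire → ℕ) → K₀-realisable F → K-realisable F

AllPtwContModulusAreK : Set
AllPtwContModulusAreK = (F : Baire → ℕ) →
  (Σ (Baire → ℕ) λ g → Modulus F g × PointwiseContinuous g) → K-realisable F

-- (1) → (2): for γ ∈ K₀, apply BI_D to the detachable bar {a | γ a > 0} and
--   the inductive predicate "the shifted function b ↦ γ (a ++ b) lies in K";
--   hence γ itself lies in K.
-- (1) → (3): for F with modulus g, apply BI_D to the detachable bar
--   {a | g (a ⊕ 0̄) ≤ |a|} and the inductive predicate "β ↦ F (a ⊕ β) is
--   K-realisable"; on the bar F (a ⊕ ·) is constant, and K-realisability is
--   closed under the sup-construction.
-- (2) → (1) and (3) → (1): a detachable bar P determines the selector F_P,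
--   where F_P α is the least n with P (ᾱ n).  It is K₀-realised by the
--   "first hit" neighbourhood function and is its own pointwise continuous
--   modulus.  If δ ∈ K realises F_P, induction on δ (with the invariant that
--   no proper prefix of the current node is a hit) proves Q ⟨⟩ for every
--   inductive Q ⊇ P.
module Submission where

open import Defs
open import Data.Nat using (ℕ; zero; suc; _<_; _≤_; pred; _+_; _∸_; z≤n; s≤s; z<s; >-nonZero; _<?_; _≤?_)
open import Data.Nat.Properties using (suc-pred; ≤-total; ≤∧≢⇒<; m+[n∸m]≡n; m≤m+n; m≤n+m; +-comm)
open import Data.List using ([]; _∷_; _++_; length)
open import Data.List.Properties using (++-identityʳ; ++-assoc; length-++)
open import Data.Maybe using (Maybe; just; nothing; map)
open import Data.Product using (∃; _×_; _,_; proj₁; proj₂)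
open import Data.Sum using (inj₁; inj₂)
open import Data.Empty using (⊥-elim)
open import Function using (_∘_)
open import Relation.Nullary using (yes; no)
open import Relation.Binary.PropositionalEquality
open import Function.Bundles using (_⇔_; mk⇔)

tail : Baire → Baire
tail α k = α (suc k)

cons : ℕ → Baire → Baire
cons x β zero    = x
cons x β (suc k) = β k

_⊕_ : Seq → Baire → Baire
[]      ⊕ β = β
(x ∷ a) ⊕ β = cons x (a ⊕ β)

zeros : Baire
zeros _ = 0

Extensional : (Baire → ℕ) → Set
Extensional F = ∀ α β → (∀ k → α k ≡ β k) → F α ≡ F β

init-cong : ∀ {α β} → (∀ k → α k ≡ β k) → ∀ n → init α n ≡ init β n
init-cong α≗β zero    = refl
init-cong α≗β (suc n) = cong₂ _∷_ (α≗β 0) (init-cong (α≗β ∘ suc) n)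

length-init : ∀ α n → length (init α n) ≡ n
length-init α zero    = refl
length-init α (suc n) = cong suc (length-init (tail α) n)

init-+ : ∀ α m d → init α (m + d) ≡ init α m ++ init (λ k → α (m + k)) d
init-+ α zero    d = refl
init-+ α (suc m) d = cong (α 0 ∷_) (init-+ (tail α) m d)

init-⊕ : ∀ a β d → init (a ⊕ β) (length a + d) ≡ a ++ init β d
init-⊕ []      β d = refl
init-⊕ (x ∷ a) β d = cong (x ∷_) (init-⊕ a β d)

init-⊕-length : ∀ a β → init (a ⊕ β) (length a) ≡ a
init-⊕-length []      β = refl
init-⊕-length (x ∷ a) β = cong (x ∷_) (init-⊕-length a β)

init-⊕-short : ∀ a β β′ n → n ≤ length a → init (a ⊕ β) n ≡ init (a ⊕ β′) n
init-⊕-short a       β β′ zero    _         = refl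
init-⊕-short (x ∷ a) β β′ (suc n) (s≤s n≤a) = cong (x ∷_) (init-⊕-short a β β′ n n≤a)

init-truncate : ∀ α k n β → n ≤ k → init (init α k ⊕ β) n ≡ init α n
init-truncate α k       zero    β _         = refl
init-truncate α (suc k) (suc n) β (s≤s n≤k) = cong (α 0 ∷_) (init-truncate (tail α) k n β n≤k)

⊕-snoc : ∀ a β k → (a ⊕ β) k ≡ ((a ++ β 0 ∷ []) ⊕ tail β) k
⊕-snoc []      β zero    = refl
⊕-snoc []      β (suc k) = refl
⊕-snoc (x ∷ a) β zero    = refl
⊕-snoc (x ∷ a) β (suc k) = ⊕-snoc a β k

length-snoc : ∀ a (j : ℕ) → length (a ++ j ∷ []) ≡ suc (length a)
length-snoc a j = trans (length-++ a) (+-comm (length a) 1)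

K₀-path-later : ∀ {γ} → K₀ γ → ∀ α {i j} → i ≤ j →
                0 < γ (init α i) → γ (init α i) ≡ γ (init α j)
K₀-path-later {γ} (_ , stable) α {i} {j} i≤j pos =
  trans (stable (init α i) _ pos) (cong γ (sym extends))
  where
  extends : init α j ≡ init α i ++ init (λ k → α (i + k)) (j ∸ i)
  extends = trans (cong (init α) (sym (m+[n∸m]≡n i≤j))) (init-+ α i (j ∸ i))

K₀-path-constant : ∀ {γ} → K₀ γ → ∀ α m n →
                   0 < γ (init α m) → 0 < γ (init α n) → γ (init α m) ≡ γ (init α n)
K₀-path-constant γ∈K₀ α m n pos-m pos-n with ≤-total m n
... | inj₁ m≤n = K₀-path-later γ∈K₀ α m≤n pos-m
... | inj₂ n≤m = sym (K₀-path-later γ∈K₀ α n≤m pos-n)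

K-cong : ∀ {γ δ} → (∀ a → γ a ≡ δ a) → K γ → K δ
K-cong γ≗δ (kconst _ n const) = kconst _ n (λ a → trans (sym (γ≗δ a)) (const a))
K-cong γ≗δ (ksup _ root sub)  = ksup _ (trans (sym (γ≗δ [])) root) (λ n → K-cong (γ≗δ ∘ (n ∷_)) (sub n))

Realises-cong : ∀ {γ F G} → (∀ β → F β ≡ G β) → Realises γ F → Realises γ G
Realises-cong F≗G r α m least = trans (sym (F≗G α)) (r α m least)

K-realisable-cong : ∀ {F G} → (∀ β → F β ≡ G β) → K-realisable F → K-realisable G
K-realisable-cong F≗G (γ , γ∈K , r) = γ , γ∈K , Realises-cong {γ} F≗G r

Realises-const : ∀ {γ F} n → (∀ a → γ a ≡ suc n) → Realises γ F → ∀ β → F β ≡ n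
Realises-const n const r β =
  trans (r β 0 (subst (0 <_) (sym (const [])) z<s , λ _ ())) (cong pred (const []))

Realises-subtree : ∀ {γ F} j → γ [] ≡ 0 → Realises γ F →
                   Realises (γ ∘ (j ∷_)) (F ∘ cons j)
Realises-subtree {γ} j root r β m (pos , below) = r (cons j β) (suc m) (pos , below′)
  where
  below′ : ∀ k → k < suc m → γ (init (cons j β) k) ≡ 0
  below′ zero    _         = root
  below′ (suc k) (s≤s k<m) = below k k<m

K-realisable-const : ∀ {F} n → (∀ β → F β ≡ n) → K-realisable F
K-realisable-const n const =
  (λ _ → suc n) , kconst _ n (λ _ → refl) , λ β _ _ → const β

K-realisable-sup : (G : ℕ → Baire → ℕ) → (∀ j → K-realisable (G j)) →
                   K-realisable (λ β → G (β 0) (tail β))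
K-realisable-sup G R = δ , ksup δ refl (λ j → proj₁ (proj₂ (R j))) , realises
  where
  δ : Seq → ℕ
  δ []      = 0
  δ (j ∷ b) = proj₁ (R j) b
  realises : Realises δ (λ β → G (β 0) (tail β))
  realises β zero    (() , _)
  realises β (suc m) (pos , below) =
    proj₂ (proj₂ (R (β 0))) (tail β) m (pos , λ k k<m → below (suc k) (s≤s k<m))

agree⇒∈ₛ : ∀ α β n → init β n ≡ init α n → β ∈ₛ init α n
agree⇒∈ₛ α β n agree = trans (cong (init β) (length-init α n)) agree

modulus⇒extensional : ∀ {F g} → Modulus F g → Extensional F
modulus⇒extensional {g = g} mod α β α≗β =
  sym (mod α β (agree⇒∈ₛ α β (g α) (sym (init-cong α≗β (g α)))))

inductive-descend : ∀ {Q} → Inductive Q → ∀ d a → (∀ β → Q (a ++ init β d)) → Q a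
inductive-descend {Q} ind zero    a hyp = subst Q (++-identityʳ a) (hyp zeros)
inductive-descend {Q} ind (suc d) a hyp = ind a λ j →
  inductive-descend ind d (a ++ j ∷ [])
    (λ β → subst Q (sym (++-assoc a (j ∷ []) (init β d))) (hyp (cons j β)))

BI-D⇒K₀⊆K : BI-D → ∀ {γ} → K₀ γ → K γ
BI-D⇒K₀⊆K bi {γ} (bar , stable) = bi Hit Shifted decide bar hit⇒shifted closed
  where
  Hit : Seq → Set
  Hit a = 0 < γ a
  Shifted : Seq → Set
  Shifted a = K (λ b → γ (a ++ b))
  decide : Detachable Hit
  decide a with 0 <? γ a
  ... | yes pos = inj₁ pos
  ... | no ¬pos = inj₂ ¬pos
  hit⇒shifted : ∀ a → Hit a → Shifted a
  hit⇒shifted a pos = kconst _ (pred (γ a)) λ b →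
    trans (sym (stable a b pos)) (sym (suc-pred (γ a) {{>-nonZero pos}}))
  closed : Inductive Shifted
  closed a sub with γ a in γa
  ... | suc _ = hit⇒shifted a (subst (0 <_) (sym γa) z<s)
  ... | zero  = ksup _ (trans (cong γ (++-identityʳ a)) γa)
                       (λ n → K-cong (λ b → cong γ (++-assoc a (n ∷ []) b)) (sub n))

one⇒two : BI-D → AllK₀RealisableAreK
one⇒two bi F (γ , γ∈K₀ , r) = γ , BI-D⇒K₀⊆K bi γ∈K₀ , r

one⇒three : BI-D → AllPtwContModulusAreK
one⇒three bi F (g , mod , g-cont) = bi Known Realisable decide bar known⇒realisable closed
  where
  extensional : Extensional F
  extensional = modulus⇒extensional mod
  -- at a the modulus, computed at a ⊕ 0̄, does not look beyond a
  Known : Seq → Set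
  Known a = g (a ⊕ zeros) ≤ length a
  Realisable : Seq → Set
  Realisable a = K-realisable (λ β → F (a ⊕ β))
  decide : Detachable Known
  decide a with g (a ⊕ zeros) ≤? length a
  ... | yes known = inj₁ known
  ... | no ¬known = inj₂ ¬known
  -- cut α after g α + n, where n is the continuity point of g at α
  bar : Bar Known
  bar α = g α + n , subst₂ _≤_ (sym (g-equal _ same-start)) (sym (length-init α (g α + n)))
                                (m≤m+n (g α) n)
    where
    n = proj₁ (g-cont α)
    g-equal = proj₂ (g-cont α)
    same-start : init (init α (g α + n) ⊕ zeros) n ≡ init α n
    same-start = init-truncate α (g α + n) n zeros (m≤n+m n (g α))
  known⇒realisable : ∀ a → Known a → Realisable a
  known⇒realisable a known = K-realisable-const (F (a ⊕ zeros)) λ β →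
    mod (a ⊕ zeros) (a ⊕ β)
        (agree⇒∈ₛ (a ⊕ zeros) (a ⊕ β) _ (init-⊕-short a β zeros _ known))
  closed : Inductive Realisable
  closed a sub = K-realisable-cong
    (λ β → extensional _ _ (sym ∘ ⊕-snoc a β))
    (K-realisable-sup (λ j β → F ((a ++ j ∷ []) ⊕ β)) sub)

firstHit : (P : Seq → Set) → Detachable P → Seq → Maybe ℕ
firstHit P dP a with dP []
... | inj₁ _ = just 0
firstHit P dP []      | inj₂ _ = nothing
firstHit P dP (x ∷ a) | inj₂ _ = map suc (firstHit (P ∘ (x ∷_)) (dP ∘ (x ∷_)) a)

firstHit-complete : ∀ P dP a → P a → ∃ λ k → firstHit P dP a ≡ just k
firstHit-complete P dP a hit with dP []
... | inj₁ _ = 0 , refl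
firstHit-complete P dP []      hit | inj₂ miss = ⊥-elim (miss hit)
firstHit-complete P dP (x ∷ a) hit | inj₂ _
  with firstHit-complete (P ∘ (x ∷_)) (dP ∘ (x ∷_)) a hit
... | k , found = suc k , cong (map suc) found

firstHit-extend : ∀ P dP a b k → firstHit P dP a ≡ just k → firstHit P dP (a ++ b) ≡ just k
firstHit-extend P dP a b k found with dP []
... | inj₁ _ = found
firstHit-extend P dP [] b k () | inj₂ _
firstHit-extend P dP (x ∷ a) b k found | inj₂ _
  with firstHit (P ∘ (x ∷_)) (dP ∘ (x ∷_)) a in found′
firstHit-extend P dP (x ∷ a) b .(suc k′) refl | inj₂ _ | just k′ =
  cong (map suc) (firstHit-extend (P ∘ (x ∷_)) (dP ∘ (x ∷_)) a b k′ found′)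

firstHit-sound : ∀ P dP α n k → firstHit P dP (init α n) ≡ just k →
                 P (init α k) × firstHit P dP (init α k) ≡ just k
firstHit-sound P dP α n k found with dP []
firstHit-sound P dP α n .0 refl | inj₁ hit = hit , refl
firstHit-sound P dP α zero k () | inj₂ _
firstHit-sound P dP α (suc n) k found | inj₂ _
  with firstHit (P ∘ (α 0 ∷_)) (dP ∘ (α 0 ∷_)) (init (tail α) n) in found′
firstHit-sound P dP α (suc n) .(suc k′) refl | inj₂ _ | just k′
  with firstHit-sound (P ∘ (α 0 ∷_)) (dP ∘ (α 0 ∷_)) (tail α) n k′ found′
... | hit , self = hit , cong (map suc) self

code : Maybe ℕ → ℕ
code nothing  = 0
code (just k) = suc k

code-pos : ∀ {m} → 0 < code m → ∃ λ k → m ≡ just k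
code-pos {just k} _ = k , refl

module Selector (P : Seq → Set) (dP : Detachable P) (bar : Bar P) where

  γP : Seq → ℕ
  γP = code ∘ firstHit P dP

  hitOn : ∀ α → ∃ λ k → firstHit P dP (init α (proj₁ (bar α))) ≡ just k
  hitOn α = firstHit-complete P dP _ (proj₂ (bar α))

  γP∈K₀ : K₀ γP
  γP∈K₀ = (λ α → proj₁ (bar α) , subst (λ m → 0 < code m) (sym (proj₂ (hitOn α))) z<s)
        , stable
    where
    stable : ∀ a b → 0 < γP a → γP a ≡ γP (a ++ b)
    stable a b pos with code-pos pos
    ... | k , found = cong code (trans found (sym (firstHit-extend P dP a b k found)))

  F : Baire → ℕ
  F α = proj₁ (hitOn α)

  F-value : ∀ α n k → firstHit P dP (init α n) ≡ just k → F α ≡ k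
  F-value α n k found = cong pred (begin
    suc (F α)                       ≡⟨ cong code (sym (proj₂ (hitOn α))) ⟩
    γP (init α (proj₁ (bar α)))     ≡⟨ K₀-path-constant γP∈K₀ α _ n (positive (proj₂ (hitOn α))) (positive found) ⟩
    γP (init α n)                   ≡⟨ cong code found ⟩
    suc k                           ∎)
    where
    open ≡-Reasoning
    positive : ∀ {a j} → firstHit P dP a ≡ just j → 0 < γP a
    positive found′ = subst (λ m → 0 < code m) (sym found′) z<s

  realises : Realises γP F
  realises α m (pos , _) with code-pos pos
  ... | k , found = trans (F-value α m k found) (cong (pred ∘ code) (sym found))

  F-hits : ∀ α → P (init α (F α))
  F-hits α = proj₁ (firstHit-sound P dP α _ (F α) (proj₂ (hitOn α)))

  F-modulus : Modulus F F
  F-modulus α β β∈ = F-value β (F α) (F α) (begin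
    firstHit P dP (init β (F α))    ≡⟨ cong (firstHit P dP) (trans (cong (init β) (sym (length-init α (F α)))) β∈) ⟩
    firstHit P dP (init α (F α))    ≡⟨ proj₂ (firstHit-sound P dP α _ (F α) (proj₂ (hitOn α))) ⟩
    just (F α)                      ∎)
    where open ≡-Reasoning

  F-continuous : PointwiseContinuous F
  F-continuous α = F α , λ β agree → F-modulus α β (agree⇒∈ₛ α β (F α) agree)

-- Induction on a Brouwer operation realising a selector F for the bar P.
-- The invariant |a| ≤ F (a ⊕ β) says that along a ⊕ β the selected hit does
-- not lie strictly inside a; at leaves F (a ⊕ ·) is constant, so every
-- extension of a by the right length is a hit.
descend-along-K : ∀ {P Q} → Detachable P → (∀ a → P a → Q a) → Inductive Q →
  ∀ F → Extensional F → (∀ α → P (init α (F α))) →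
  ∀ {δ} → K δ → ∀ a → Realises δ (λ β → F (a ⊕ β)) → (∀ β → length a ≤ F (a ⊕ β)) → Q a
descend-along-K {P} dP P⊆Q ind F ext hits (kconst _ n const) a r above =
  inductive-descend ind (n ∸ length a) a λ β →
    P⊆Q _ (subst P (init-⊕ a β _) (subst (P ∘ init (a ⊕ β)) (F-is β) (hits (a ⊕ β))))
  where
  F-is : ∀ β → F (a ⊕ β) ≡ length a + (n ∸ length a)
  F-is β = trans (Realises-const n const r β)
                 (sym (m+[n∸m]≡n (subst (length a ≤_) (Realises-const n const r zeros) (above zeros))))
descend-along-K {P} dP P⊆Q ind F ext hits (ksup δ root sub) a r above with dP a
... | inj₁ hit  = P⊆Q a hit
... | inj₂ miss = ind a λ j →
  descend-along-K dP P⊆Q ind F ext hits (sub j) (a ++ j ∷ []) (realises-child j) (above-child j)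
  where
  realises-child : ∀ j → Realises (δ ∘ (j ∷_)) (λ β → F ((a ++ j ∷ []) ⊕ β))
  realises-child j = Realises-cong {δ ∘ (j ∷_)} (λ β → ext _ _ (⊕-snoc a (cons j β)))
                                               (Realises-subtree {δ} j root r)
  -- F (a ⊕ cons j β) = |a| would make a itself a hit
  strictly-above : ∀ j β → length a < F (a ⊕ cons j β)
  strictly-above j β = ≤∧≢⇒< (above (cons j β)) λ at-a →
    miss (subst P (init-⊕-length a (cons j β)) (subst (P ∘ init (a ⊕ cons j β)) (sym at-a) (hits _)))
  above-child : ∀ j β → length (a ++ j ∷ []) ≤ F ((a ++ j ∷ []) ⊕ β)
  above-child j β = subst₂ _≤_ (sym (length-snoc a j)) (ext _ _ (⊕-snoc a (cons j β)))
                               (strictly-above j β)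

BI-D-from-selectors : (∀ P dP bar → K-realisable (Selector.F P dP bar)) → BI-D
BI-D-from-selectors realise P Q dP bar P⊆Q ind with realise P dP bar
... | δ , δ∈K , r =
  descend-along-K dP P⊆Q ind F (modulus⇒extensional F-modulus) F-hits δ∈K [] r (λ _ → z≤n)
  where open Selector P dP bar

proposition5p3 : (BI-D ⇔ AllK₀RealisableAreK) × (BI-D ⇔ AllPtwContModulusAreK)
proposition5p3 =
    mk⇔ one⇒two   (λ two → BI-D-from-selectors λ P dP bar →
                     let open Selector P dP bar in two F (γP , γP∈K₀ , realises))
  , mk⇔ one⇒three (λ three → BI-D-from-selectors λ P dP bar →
                     let open Selector P dP bar in three F (F , F-modulus , F-continuous))
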